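{- As formal power series, $$\sum_{n=1}^{\infty}x^{e(n)}=\frac{1}{1-3x}.$$ Equivalently, for every integer $k\ge 0$, the number of positive integers $i$ with $e(i)=k$ is exactly $3^{k}$.
   Context: The Stern polynomials $B_n(t)\in\mathbb{Z}[t]$, $n\ge 0$, are defined by $B_0(t)=0$, $B_1(t)=1$, $B_{2n}(t)=tB_n(t)$ and $B_{2n+1}(t)=B_n(t)+B_{n+1}(t)$ for $n\ge 1$. For $n\ge 1$, $e(n)=\deg_t B_n(t)$. -}

module Defs where

open import Data.Integer.Base as ℤ using (ℤ; 0ℤ; 1ℤ)
import Data.Integer.Properties as ℤ
open import Data.Fin.Base using (toℕ)
open import Data.List.Base using (List; []; _∷_; foldr)
open import Data.Maybe using (Maybe; just; nothing; Is-just; to-witness)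
open import Data.Maybe.Relation.Unary.Any using (just)
open import Data.Nat.Base
open import Data.Nat.Induction using (Acc; acc; <-wellFounded)
open import Data.Nat.Properties using (⌊n/2⌋<n; ⌈n/2⌉<n; +-suc; +-identityʳ; _≟_)
open import Data.Parity.Base using (Parity; 0ℙ; 1ℙ)
open import Data.Product.Base using (Σ; ∃-syntax; _×_)
open import Data.Unit.Base using (tt)
open import Relation.Binary.PropositionalEquality
open import Relation.Nullary using (yes; no; contradiction)
open import Algebra.Properties.CommutativeMonoid.Sum ℤ.+-0-commutativeMonoid public
  using (sum-syntax; sum⁺-syntax)

-- A polynomial in ℤ[t] is a list of coefficients, constant term first.
-- Trailing zeros are allowed.
Poly : Set
Poly = List ℤ

infixl 6 _⊕_

_⊕_ : Poly → Poly → Poly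
[]      ⊕ q       = q
(a ∷ p) ⊕ []      = a ∷ p
(a ∷ p) ⊕ (b ∷ q) = (a ℤ.+ b) ∷ (p ⊕ q)

t·_ : Poly → Poly
t· p = 0ℤ ∷ p

-- The zero polynomial has no degree; trailing zeros do not count.
deg : Poly → Maybe ℕ
deg []      = nothing
deg (a ∷ p) with deg p
... | just d  = just (suc d)
... | nothing with a ℤ.≟ 0ℤ
...   | yes _ = nothing
...   | no  _ = just 0

sternStep : Parity → Poly → Poly → Poly
sternStep 0ℙ p q = t· p
sternStep 1ℙ p q = p ⊕ q

sternAcc : ∀ n → Acc _<_ n → Poly
sternAcc 0               _        = []
sternAcc 1               _        = 1ℤ ∷ []
sternAcc n@(suc (suc m)) (acc rs) =
  sternStep (parity n)
    (sternAcc ⌊ n /2⌋ (rs (⌊n/2⌋<n (suc m))))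
    (sternAcc ⌈ n /2⌉ (rs (⌈n/2⌉<n m)))

-- The defining recurrences are B-double and B-double+1 below.
B : ℕ → Poly
B n = sternAcc n (<-wellFounded n)

private
  sternAcc-irrelevant : ∀ n (p q : Acc _<_ n) → sternAcc n p ≡ sternAcc n q
  sternAcc-irrelevant 0               _        _        = refl
  sternAcc-irrelevant 1               _        _        = refl
  sternAcc-irrelevant n@(suc (suc m)) (acc rs) (acc ss) =
    cong₂ (sternStep (parity n))
      (sternAcc-irrelevant ⌊ n /2⌋ _ _)
      (sternAcc-irrelevant ⌈ n /2⌉ _ _)

  B-step : ∀ m → let n = suc (suc m) in
           B n ≡ sternStep (parity n) (B ⌊ n /2⌋) (B ⌈ n /2⌉)
  B-step m = cong₂ (sternStep (parity m))
    (sternAcc-irrelevant (suc ⌊ m /2⌋) _ _) (sternAcc-irrelevant (suc ⌊ suc m /2⌋) _ _)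

  parity-dbl : ∀ n → parity (n + n) ≡ 0ℙ
  parity-dbl zero    = refl
  parity-dbl (suc n) rewrite +-suc n n = parity-dbl n

  parity-dbl+1 : ∀ n → parity (suc (n + n)) ≡ 1ℙ
  parity-dbl+1 zero    = refl
  parity-dbl+1 (suc n) rewrite +-suc n n = parity-dbl+1 n

  half-dbl : ∀ n → ⌊ n + n /2⌋ ≡ n
  half-dbl zero    = refl
  half-dbl (suc n) rewrite +-suc n n = cong suc (half-dbl n)

  half-dbl+1 : ∀ n → ⌊ suc (n + n) /2⌋ ≡ n
  half-dbl+1 zero    = refl
  half-dbl+1 (suc n) rewrite +-suc n n = cong suc (half-dbl+1 n)

B-double : ∀ n .{{_ : NonZero n}} → B (2 * n) ≡ t· B n
B-double (suc m) rewrite +-identityʳ m | +-suc m m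
  = trans (B-step (m + m)) (lemma (parity-dbl m) (cong suc (half-dbl m)))
  where
  lemma : ∀ {π h q} → π ≡ 0ℙ → h ≡ suc m →
          sternStep π (B h) q ≡ t· B (suc m)
  lemma refl refl = refl

B-double+1 : ∀ n .{{_ : NonZero n}} → B (2 * n + 1) ≡ B n ⊕ B (n + 1)
B-double+1 (suc m)
  rewrite +-identityʳ m | +-suc m m | +-suc (m + m) 0 | +-identityʳ (m + m)
        | +-suc m 0 | +-identityʳ m
  = trans (B-step (suc (m + m)))
      (lemma (parity-dbl+1 m) (cong suc (half-dbl+1 m)) (cong (λ k → suc (suc k)) (half-dbl m)))
  where
  lemma : ∀ {π h c} → π ≡ 1ℙ → h ≡ suc m → c ≡ suc (suc m) →
          sternStep π (B h) (B c) ≡ B (suc m) ⊕ B (suc (suc m))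
  lemma refl refl refl = refl

private
  eval₁ : Poly → ℤ
  eval₁ = foldr ℤ._+_ 0ℤ

  eval₁-⊕ : ∀ p q → eval₁ (p ⊕ q) ≡ eval₁ p ℤ.+ eval₁ q
  eval₁-⊕ []      q  = sym (ℤ.+-identityˡ _)
  eval₁-⊕ (a ∷ p) [] = sym (ℤ.+-identityʳ _)
  eval₁-⊕ (a ∷ p) (b ∷ q) = begin
    (a ℤ.+ b) ℤ.+ eval₁ (p ⊕ q)             ≡⟨ cong (ℤ._+_ (a ℤ.+ b)) (eval₁-⊕ p q) ⟩
    (a ℤ.+ b) ℤ.+ (eval₁ p ℤ.+ eval₁ q)     ≡⟨ ℤ.+-assoc a b _ ⟩
    a ℤ.+ (b ℤ.+ (eval₁ p ℤ.+ eval₁ q))     ≡⟨ cong (ℤ._+_ a) (sym (ℤ.+-assoc b _ _)) ⟩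
    a ℤ.+ ((b ℤ.+ eval₁ p) ℤ.+ eval₁ q)     ≡⟨ cong (λ z → a ℤ.+ (z ℤ.+ eval₁ q)) (ℤ.+-comm b _) ⟩
    a ℤ.+ ((eval₁ p ℤ.+ b) ℤ.+ eval₁ q)     ≡⟨ cong (ℤ._+_ a) (ℤ.+-assoc (eval₁ p) b _) ⟩
    a ℤ.+ (eval₁ p ℤ.+ (b ℤ.+ eval₁ q))     ≡⟨ sym (ℤ.+-assoc a _ _) ⟩
    (a ℤ.+ eval₁ p) ℤ.+ (b ℤ.+ eval₁ q)     ∎
    where open ≡-Reasoning

  deg-nothing : ∀ p → deg p ≡ nothing → eval₁ p ≡ 0ℤ
  deg-nothing []      _ = refl
  deg-nothing (a ∷ p) eq with deg p in dp
  deg-nothing (a ∷ p) () | just _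
  deg-nothing (a ∷ p) eq | nothing with a ℤ.≟ 0ℤ
  deg-nothing (a ∷ p) eq | nothing | yes refl =
    trans (ℤ.+-identityˡ _) (deg-nothing p dp)
  deg-nothing (a ∷ p) () | nothing | no _

  step-positive : ∀ π {p q} → 0ℤ ℤ.< eval₁ p → 0ℤ ℤ.< eval₁ q →
                  0ℤ ℤ.< eval₁ (sternStep π p q)
  step-positive 0ℙ {p} hp hq = subst (0ℤ ℤ.<_) (sym (ℤ.+-identityˡ (eval₁ p))) hp
  step-positive 1ℙ {p} {q} hp hq =
    subst (0ℤ ℤ.<_) (sym (eval₁-⊕ p q)) (ℤ.+-mono-< hp hq)

  eval₁-positive : ∀ n (r : Acc _<_ (suc n)) → 0ℤ ℤ.< eval₁ (sternAcc (suc n) r)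
  eval₁-positive 0       _        = ℤ.+<+ z<s
  eval₁-positive (suc m) (acc rs) =
    step-positive (parity (suc (suc m)))
      (eval₁-positive ⌊ m /2⌋ _) (eval₁-positive ⌊ suc m /2⌋ _)

B-nonzero : ∀ n .{{_ : NonZero n}} → Is-just (deg (B n))
B-nonzero (suc n) with deg (B (suc n)) in eq
... | just _  = just tt
... | nothing = contradiction (eval₁-positive n (<-wellFounded (suc n)))
                  (ℤ.<-irrefl (sym (deg-nothing (B (suc n)) eq)))

e : (n : ℕ) .{{_ : NonZero n}} → ℕ
e n = to-witness (B-nonzero n)

PowerSeries : Set
PowerSeries = ℕ → ℤ

monomial : ℤ → ℕ → PowerSeries
monomial c n k with k ≟ n
... | yes _ = c
... | no  _ = 0ℤ

infixl 6 _⊖_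
infixl 7 _⊛_

_⊖_ : PowerSeries → PowerSeries → PowerSeries
(f ⊖ g) k = f k ℤ.- g k

_⊛_ : PowerSeries → PowerSeries → PowerSeries
(f ⊛ g) k = ∑[ i ≤ k ] (f (toℕ i) ℤ.* g (k ∸ toℕ i))

-- g = 1 / f in ℤ⟦x⟧ (unique when it exists, as the ring is commutative).
_IsReciprocalOf_ : PowerSeries → PowerSeries → Set
g IsReciprocalOf f = f ⊛ g ≗ monomial 1ℤ 0

-- Σ_{n ≥ 0} f n = s in the x-adic topology: each coefficient of the
-- partial sums is eventually constant, equal to that of s.
_SumsTo_ : (ℕ → PowerSeries) → PowerSeries → Set
f SumsTo s = ∀ k → ∃[ N ] (∀ M → N ≤ M → ∑[ n < M ] f (toℕ n) k ≡ s k)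

-- The degree fibre {n ≥ 1 | e n = k}.  NonZero n and e n ≡ k are propositions,
-- so distinct elements have distinct n.
DegreeFibre : ℕ → Set
DegreeFibre k = Σ ℕ λ n → Σ (NonZero n) λ nz → e n {{nz}} ≡ k

-- Write δ m = e (suc m).  Degrees add up as a maximum because the coefficients of
-- B n are non-negative, so δ (2m+1) = δ m + 1 and δ (2m+2) = δ m ⊔ δ (m+1).
-- Consecutive values of δ differ by at most one, which collapses the maxima at
-- 4m+2 and 4m+4 to δ m + 1.  Each j ≥ 1 is of exactly one of the forms 2m+1, 4m+2,
-- 4m+4, so the fibre of δ over k+1 is three copies of the fibre over k.
module Submission where

open import Defs
open import Data.Nat using (ℕ; suc; _^_)
open import Data.Integer using (1ℤ; +_)
open import Data.Fin using (Fin)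
open import Data.Product using (_×_; ∃-syntax)
open import Function.Bundles using (_↔_)

open import Data.Fin using (zero; suc; toℕ; fromℕ<; punchIn)
open import Data.Fin.Properties using (1↔⊤; *↔×; punchInᵢ≢i; toℕ-fromℕ<; toℕ-injective)
open import Data.Integer using (0ℤ; -[1+_])
import Data.Integer as ℤ
import Data.Integer.Properties as ℤ
import Data.Integer.Solver as ℤ
open import Data.List using ([]; _∷_)
open import Data.Maybe using (just; Is-just; to-witness)
open import Data.Maybe.Properties using (just-injective)
open import Data.Maybe.Relation.Unary.Any using (just)
open import Data.Nat using (zero; _+_; _∸_; _*_; _⊔_; _≤_; _<_; z≤n; s≤s; _≟_; ⌊_/2⌋; parity)
open import Data.Nat.Binary using (ℕᵇ; 2[1+_]; 1+[2_])
import Data.Nat.Binary as ℕᵇ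
import Data.Nat.Binary.Properties as ℕᵇ
open import Data.Nat.Induction using (Acc; acc; <-wellFounded)
open import Data.Nat.Properties
  using (≡-irrelevant; +-comm; *-comm; *-suc; ≤-refl; ≤-trans; n≤1+n;
         m≤m⊔n; m≤n⊔m; ⊔-lub; m≥n⇒m⊔n≡m; m≤n⇒m⊔n≡n; suc-injective)
import Data.Nat.Solver as ℕ
open import Data.Parity.Base using (0ℙ; 1ℙ)
open import Data.Product using (_,_; proj₁; proj₂)
open import Data.Product.Function.NonDependent.Propositional using (_×-↔_)
open import Data.Unit using (⊤; tt)
open import Function using (_∘_)
open import Function.Bundles using (mk↔ₛ′; Inverse)
open import Function.Properties.Inverse using (↔-refl; ↔-sym; ↔-trans)
open import Relation.Binary.PropositionalEquality
open import Relation.Nullary using (yes; no; contradiction)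
open import Algebra.Properties.CommutativeMonoid.Sum ℤ.+-0-commutativeMonoid
  using (sum; sum-remove; sum-cong-≗; sum-replicate-zero; ∑-comm)

-- Degrees of Stern polynomials.

-- Requiring non-negative coefficients rules out cancellation in `_⊕_`, and a positive last one
-- rules out trailing zeros. Both branches of `sternStep` preserve this.
data Leads : ℕ → Poly → Set where
  last : ∀ {a} → 0ℤ ℤ.< a → Leads 0 (a ∷ [])
  cons : ∀ {a d p} → 0ℤ ℤ.≤ a → Leads d p → Leads (suc d) (a ∷ p)

deg-Leads : ∀ {d p} → Leads d p → deg p ≡ just d
deg-Leads (last {a} 0<a) with a ℤ.≟ 0ℤ
... | yes a≡0 = contradiction 0<a (ℤ.<-irrefl (sym a≡0))
... | no  _   = refl
deg-Leads (cons _ l) rewrite deg-Leads l = refl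

⊕-Leads : ∀ {m n p q} → Leads m p → Leads n q → Leads (m ⊔ n) (p ⊕ q)
⊕-Leads (last 0<a)   (last 0<b)   = last (ℤ.+-mono-< 0<a 0<b)
⊕-Leads (last 0<a)   (cons 0≤b l) = cons (ℤ.+-mono-≤ (ℤ.<⇒≤ 0<a) 0≤b) l
⊕-Leads (cons 0≤a k) (last 0<b)   = cons (ℤ.+-mono-≤ 0≤a (ℤ.<⇒≤ 0<b)) (subst (Leads _) (sym (⊕-identityʳ _)) k)
  where
  ⊕-identityʳ : ∀ p → p ⊕ [] ≡ p
  ⊕-identityʳ []      = refl
  ⊕-identityʳ (_ ∷ _) = refl
⊕-Leads (cons 0≤a k) (cons 0≤b l) = cons (ℤ.+-mono-≤ 0≤a 0≤b) (⊕-Leads k l)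

sternStep-Leads : ∀ π {m n p q} → Leads m p → Leads n q → ∃[ d ] Leads d (sternStep π p q)
sternStep-Leads 0ℙ k l = _ , cons ℤ.≤-refl k
sternStep-Leads 1ℙ k l = _ , ⊕-Leads k l

-- Follows the recursion of `sternAcc` for an arbitrary accessibility proof, so only existence of
-- `d` is claimed; `δ-unique` identifies it with `δ` afterwards.
sternAcc-Leads : ∀ m (r : Acc _<_ (suc m)) → ∃[ d ] Leads d (sternAcc (suc m) r)
sternAcc-Leads zero    _        = 0 , last (ℤ.+<+ (s≤s z≤n))
sternAcc-Leads (suc m) (acc rs) =
  sternStep-Leads (parity (suc (suc m)))
    (proj₂ (sternAcc-Leads ⌊ m /2⌋ _)) (proj₂ (sternAcc-Leads ⌊ suc m /2⌋ _))

δ : ℕ → ℕ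
δ m = e (suc m)

just-to-witness : ∀ {x} (j : Is-just {A = ℕ} x) → x ≡ just (to-witness j)
just-to-witness (just _) = refl

δ-unique : ∀ m {d} → Leads d (B (suc m)) → δ m ≡ d
δ-unique m l = just-injective (trans (sym (just-to-witness (B-nonzero (suc m)))) (deg-Leads l))

B-Leads : ∀ m → Leads (δ m) (B (suc m))
B-Leads m with sternAcc-Leads m (<-wellFounded (suc m))
... | d , l = subst (λ k → Leads k (B (suc m))) (sym (δ-unique m l)) l

-- The shift by one swaps parities: `δ (suc (2 * m))` is the degree of `B (2 * suc m)`, which is
-- `t· B (suc m)`.
δ-odd : ∀ m → δ (suc (2 * m)) ≡ suc (δ m)
δ-odd m = δ-unique (suc (2 * m)) (subst (Leads _)
  (trans (sym (B-double (suc m))) (cong B (*-suc 2 m)))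
  (cons ℤ.≤-refl (B-Leads m)))

δ-even : ∀ m → δ (2 * suc m) ≡ δ m ⊔ δ (suc m)
δ-even m = δ-unique (2 * suc m)
  (subst (Leads _) (sym B-odd) (⊕-Leads (B-Leads m) (B-Leads (suc m))))
  where
  B-odd : B (suc (2 * suc m)) ≡ B (suc m) ⊕ B (suc (suc m))
  B-odd = trans (cong B (+-comm 1 (2 * suc m)))
            (trans (B-double+1 (suc m)) (cong (λ n → B (suc m) ⊕ B n) (+-comm (suc m) 1)))

-- The ternary splitting of the positive integers.

-- child i m is the predecessor of 2m+1, 4m+2 or 4m+4.
child : Fin 3 × ℕ → ℕ
child (zero          , m) = m * 2
child (suc zero      , m) = suc (m * 4)
child (suc (suc zero), m) = suc (suc (suc (m * 4)))

-- Four is a common period of the three forms, so `m` grows by two in the form 2m+1 and by one in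
-- the others.
next : Fin 3 × ℕ → Fin 3 × ℕ
next (zero  , m) = zero  , suc (suc m)
next (suc i , m) = suc i , suc m

parent : ℕ → Fin 3 × ℕ
parent 0 = zero , 0
parent 1 = suc zero , 0
parent 2 = zero , 1
parent 3 = suc (suc zero) , 0
parent (suc (suc (suc (suc j)))) = next (parent j)

-- Computes because `_*_` recurses on its left argument, hence `m * 2` and `m * 4` in `child`.
child-next : ∀ x → child (next x) ≡ 4 + child x
child-next (zero           , m) = refl
child-next (suc zero       , m) = refl
child-next (suc (suc zero) , m) = refl

child-parent : ∀ j → child (parent j) ≡ j
child-parent 0 = refl
child-parent 1 = refl
child-parent 2 = refl
child-parent 3 = refl
child-parent (suc (suc (suc (suc j)))) =
  trans (child-next (parent j)) (cong (λ n → 4 + n) (child-parent j))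

parent-child : ∀ x → parent (child x) ≡ x
parent-child (zero , 0)           = refl
parent-child (zero , 1)           = refl
parent-child (zero , suc (suc m)) = cong next (parent-child (zero , m))
parent-child (suc zero , 0)           = refl
parent-child (suc zero , suc m)       = cong next (parent-child (suc zero , m))
parent-child (suc (suc zero) , 0)     = refl
parent-child (suc (suc zero) , suc m) = cong next (parent-child (suc (suc zero) , m))

-- Fibres of a function satisfying the degree recurrences.

WithinOne : ℕ → ℕ → Set
WithinOne a b = a ≤ suc b × b ≤ suc a

Fibre : (ℕ → ℕ) → ℕ → Set
Fibre f k = ∃[ m ] f m ≡ k

Fibre-≡ : ∀ {f k} {x y : Fibre f k} → proj₁ x ≡ proj₁ y → x ≡ y
Fibre-≡ refl = cong (_ ,_) (≡-irrelevant _ _)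

module DegreeRecurrence
  (f : ℕ → ℕ)
  (f-0    : f 0 ≡ 0)
  (f-odd  : ∀ m → f (suc (2 * m)) ≡ suc (f m))
  (f-even : ∀ m → f (2 * suc m) ≡ f m ⊔ f (suc m))
  where

  Close : ℕ → Set
  Close m = WithinOne (f m) (f (suc m))

  -- Here and in `close-even`, `f m ⊔ f (suc m)` is compared with the successor of one of its
  -- arguments. By `Close m` the maximum lies between that argument and its successor.
  close-odd : ∀ {m} → Close m → Close (suc (2 * m))
  close-odd {m} (_ , h)
    rewrite f-odd m | sym (*-suc 2 m) | f-even m =
    s≤s (m≤m⊔n _ _) , ≤-trans (⊔-lub (n≤1+n _) h) (n≤1+n _)

  close-even : ∀ {m} → Close m → Close (2 * suc m)
  close-even {m} (h , _)
    rewrite f-odd (suc m) | f-even m =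
    ≤-trans (⊔-lub h (n≤1+n _)) (n≤1+n _) , s≤s (m≤n⊔m _ _)

  -- Induction on binary numerals: the constructors `1+[2_]` and `2[1+_]` match the index shapes of
  -- `f-odd` and `f-even`.
  f-close : ∀ m → Close m
  f-close m = subst Close (ℕᵇ.toℕ-fromℕ m) (go (ℕᵇ.fromℕ m))
    where
    go : ∀ x → Close (ℕᵇ.toℕ x)
    go ℕᵇ.zero  = subst₂ WithinOne (sym f-0) (sym (trans (f-odd 0) (cong suc f-0))) (z≤n , ≤-refl)
    go 2[1+ x ] = close-even (go x)
    go 1+[2 x ] = close-odd (go x)

  -- With `f-above-odd`, the value at an odd index dominates both neighbours, so the maximum in
  -- `f-even` at 4m+2 and at 4m+4 is `f (suc (2 * m))`.
  f-below-odd : ∀ m → f (2 * m) ≤ f (suc (2 * m))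
  f-below-odd zero    = subst (_≤ f 1) (sym f-0) z≤n
  f-below-odd (suc m)
    rewrite f-odd (suc m) | f-even m = ⊔-lub (proj₁ (f-close m)) (n≤1+n _)

  f-above-odd : ∀ m → f (suc (suc (2 * m))) ≤ f (suc (2 * m))
  f-above-odd m
    rewrite sym (*-suc 2 m) | f-odd m | f-even m = ⊔-lub (n≤1+n _) (proj₂ (f-close m))

  f-4m+2 : ∀ m → f (2 * suc (2 * m)) ≡ suc (f m)
  f-4m+2 m = trans (f-even (2 * m)) (trans (m≤n⇒m⊔n≡n (f-below-odd m)) (f-odd m))

  f-4m+4 : ∀ m → f (2 * suc (suc (2 * m))) ≡ suc (f m)
  f-4m+4 m = trans (f-even (suc (2 * m))) (trans (m≥n⇒m⊔n≡m (f-above-odd m)) (f-odd m))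

  f-child : ∀ x → f (suc (child x)) ≡ suc (f (proj₂ x))
  f-child (zero , m) = trans (cong (λ n → f (suc n)) (*-comm m 2)) (f-odd m)
  f-child (suc zero , m) = trans
    (cong f (solve 1 (λ m → con 2 :+ m :* con 4 := con 2 :* (con 1 :+ con 2 :* m)) refl m))
    (f-4m+2 m)
    where open ℕ.+-*-Solver
  f-child (suc (suc zero) , m) = trans
    (cong f (solve 1 (λ m → con 4 :+ m :* con 4 := con 2 :* (con 2 :+ con 2 :* m)) refl m))
    (f-4m+4 m)
    where open ℕ.+-*-Solver

  f-parent : ∀ j → f (suc j) ≡ suc (f (proj₂ (parent j)))
  f-parent j = trans (cong (f ∘ suc) (sym (child-parent j))) (f-child (parent j))

  -- Every positive argument has a parent, so its value is a successor.
  fibre-zero : Fibre f 0 ↔ ⊤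
  fibre-zero = mk↔ₛ′ (λ _ → tt) (λ _ → 0 , f-0) (λ _ → refl) (λ x → Fibre-≡ (sym (isZero x)))
    where
    isZero : (x : Fibre f 0) → proj₁ x ≡ 0
    isZero (zero  , _)  = refl
    isZero (suc j , eq) = contradiction (trans (sym (f-parent j)) eq) λ ()

  fibre-suc : ∀ k → Fibre f (suc k) ↔ (Fin 3 × Fibre f k)
  fibre-suc k = mk↔ₛ′ to from to∘from from∘to
    where
    to : Fibre f (suc k) → Fin 3 × Fibre f k
    to (zero  , eq) = contradiction (trans (sym f-0) eq) λ ()
    to (suc j , eq) =
      proj₁ (parent j) , proj₂ (parent j) , suc-injective (trans (sym (f-parent j)) eq)

    from : Fin 3 × Fibre f k → Fibre f (suc k)
    from (i , m , eq) = suc (child (i , m)) , trans (f-child (i , m)) (cong suc eq)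

    to∘from : ∀ y → to (from y) ≡ y
    to∘from (i , m , eq) =
      cong₂ _,_ (cong proj₁ (parent-child (i , m))) (Fibre-≡ (cong proj₂ (parent-child (i , m))))

    from∘to : ∀ x → from (to x) ≡ x
    from∘to (zero  , eq) = contradiction (trans (sym f-0) eq) λ ()
    from∘to (suc j , eq) = Fibre-≡ (cong suc (child-parent j))

  fibre-size : ∀ k → Fibre f k ↔ Fin (3 ^ k)
  fibre-size zero    = ↔-trans fibre-zero (↔-sym 1↔⊤)
  fibre-size (suc k) = ↔-trans (fibre-suc k) (↔-trans (↔-refl ×-↔ fibre-size k) (↔-sym *↔×))

open DegreeRecurrence δ refl δ-odd δ-even using (fibre-size)

degreeFibre : ∀ k → DegreeFibre k ↔ Fibre δ k
degreeFibre k = mk↔ₛ′ to (λ (m , eq) → suc m , _ , eq) (λ _ → refl) from∘to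
  where
  to : DegreeFibre k → Fibre δ k
  to (suc m , _ , eq) = m , eq

  from∘to : ∀ x → (suc (proj₁ (to x)) , _ , proj₂ (to x)) ≡ x
  -- At a successor the `NonZero` component is unique by eta.
  from∘to (suc m , _ , eq) = refl

-- From fibre sizes to the generating function.

monomial-≡ : ∀ c {n k} → k ≡ n → monomial c n k ≡ c
monomial-≡ c {n} {k} eq with k ≟ n
... | yes _ = refl
... | no ne = contradiction eq ne

monomial-≢ : ∀ c {n k} → k ≢ n → monomial c n k ≡ 0ℤ
monomial-≢ c {n} {k} ne with k ≟ n
... | yes eq = contradiction eq ne
... | no _   = refl

sum-zero : ∀ {n} (t : Fin n → ℤ.ℤ) → (∀ j → t j ≡ 0ℤ) → sum t ≡ 0ℤ
sum-zero {n} t t≡0 = trans (sum-cong-≗ t≡0) (sum-replicate-zero n)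

sum-single : ∀ {n} (t : Fin n → ℤ.ℤ) i → (∀ j → j ≢ i → t j ≡ 0ℤ) → sum t ≡ t i
sum-single {suc n} t i t≡0 = trans (sum-remove {i = i} t)
  (trans (cong (ℤ._+_ (t i)) (sum-zero _ (λ j → t≡0 (punchIn i j) (punchInᵢ≢i i j)))) (ℤ.+-identityʳ _))

sum-one : ∀ n → ∑[ i < n ] 1ℤ ≡ + n
sum-one zero    = refl
sum-one (suc n) = cong (ℤ._+_ 1ℤ) (sum-one n)

-- Gives the threshold past which partial sums contain every element of a finite fibre.
bounded : ∀ {n} (f : Fin n → ℕ) → ∃[ N ] (∀ i → f i < N)
bounded {zero}  f = 0 , λ ()
bounded {suc n} f with bounded (f ∘ suc)
... | N , f<N = suc (f zero) ⊔ N , λ where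
  zero    → m≤m⊔n (suc (f zero)) N
  (suc i) → ≤-trans (f<N i) (m≤n⊔m (suc (f zero)) N)

-- Double counting of the pairs (n , i) for which i labels the fibre element n.
count-fibre : ∀ {f k c} → Fibre f k ↔ Fin c →
  ∃[ N ] (∀ M → N ≤ M → ∑[ n < M ] monomial 1ℤ (f (toℕ n)) k ≡ + c)
count-fibre {f} {k} {c} φ = proj₁ (bounded ι) , λ M N≤M → begin
  ∑[ n < M ] monomial 1ℤ (f (toℕ n)) k               ≡⟨ sum-cong-≗ {M} (λ n → row (toℕ n)) ⟩
  ∑[ n < M ] ∑[ i < c ] monomial 1ℤ (ι i) (toℕ n)    ≡⟨ ∑-comm {M} {c} _ ⟩
  ∑[ i < c ] ∑[ n < M ] monomial 1ℤ (ι i) (toℕ n)    ≡⟨ sum-cong-≗ {c} (λ i → column (≤-trans (proj₂ (bounded ι) i) N≤M)) ⟩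
  ∑[ i < c ] 1ℤ                                      ≡⟨ sum-one c ⟩
  + c                                                ∎
  where
  open ≡-Reasoning
  open Inverse φ using (to; from; strictlyInverseˡ; strictlyInverseʳ)

  ι : Fin c → ℕ
  ι i = proj₁ (from i)

  row : ∀ n → monomial 1ℤ (f n) k ≡ ∑[ i < c ] monomial 1ℤ (ι i) n
  row n with k ≟ f n
  -- Only the label `to x` contributes: a label `j` with `ι j` equal to `n` names the same fibre
  -- element, by `Fibre-≡`.
  ... | yes eq = sym (trans
    (sum-single _ (to x) λ j j≢ → monomial-≢ 1ℤ {ι j} λ n≡ →
      j≢ (trans (sym (strictlyInverseˡ j)) (cong to (Fibre-≡ (sym n≡)))))
    (monomial-≡ 1ℤ (sym (cong proj₁ (strictlyInverseʳ x)))))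
    where
    x : Fibre f k
    x = n , sym eq
  ... | no ne = sym (sum-zero _ λ i → monomial-≢ 1ℤ {ι i} λ n≡ →
    ne (sym (trans (cong f n≡) (proj₂ (from i)))))

  column : ∀ {a M} → a < M → ∑[ n < M ] monomial 1ℤ a (toℕ n) ≡ 1ℤ
  column {a} a<M = trans
    (sum-single _ (fromℕ< a<M) λ j j≢ → monomial-≢ 1ℤ λ eq →
      j≢ (toℕ-injective (trans eq (sym (toℕ-fromℕ< a<M)))))
    (monomial-≡ 1ℤ (toℕ-fromℕ< a<M))

geometric : PowerSeries
geometric k = + (3 ^ k)

geometric-reciprocal : geometric IsReciprocalOf (monomial 1ℤ 0 ⊖ monomial (+ 3) 1)
geometric-reciprocal zero    = refl
-- The coefficients 1 and -3 give the first two terms of the convolution, which cancel; `tail` holds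
-- the terms from the third on, all zero.
geometric-reciprocal (suc k) = begin
  1ℤ ℤ.* + (3 * 3 ^ k) ℤ.+ (-[1+ 2 ] ℤ.* + (3 ^ k) ℤ.+ sum tail)
    ≡⟨ cong₂ (λ x y → 1ℤ ℤ.* x ℤ.+ (-[1+ 2 ] ℤ.* + (3 ^ k) ℤ.+ y)) (ℤ.pos-* 3 (3 ^ k)) (sum-zero tail (λ _ → refl)) ⟩
  1ℤ ℤ.* (+ 3 ℤ.* + (3 ^ k)) ℤ.+ (-[1+ 2 ] ℤ.* + (3 ^ k) ℤ.+ 0ℤ)
    ≡⟨ solve 1 (λ x → con 1ℤ :* (con (+ 3) :* x) :+ (con -[1+ 2 ] :* x :+ con 0ℤ) := con 0ℤ) refl (+ (3 ^ k)) ⟩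
  0ℤ ∎
  where
  open ≡-Reasoning
  open ℤ.+-*-Solver
  tail : Fin k → ℤ.ℤ
  tail i = 0ℤ ℤ.* geometric (suc k ∸ suc (suc (toℕ i)))

theorem4p1 : (∃[ S ] ( ((λ n → monomial 1ℤ (e (suc n))) SumsTo S)
    × (S IsReciprocalOf (monomial 1ℤ 0 ⊖ monomial (+ 3) 1)) ))
    × (∀ (k : ℕ) → DegreeFibre k ↔ Fin (3 ^ k))
theorem4p1 =
  (geometric , (λ k → count-fibre (fibre-size k)) , geometric-reciprocal) ,
  (λ k → ↔-trans (degreeFibre k) (fibre-size k))
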